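{- Let $l\geq2$ be an integer and $U=U(P,Q)$ a $\Delta$-regular Lucas sequence such that $C_{U,l}$ is a multi-Catalan sequence. Then: (1) if $l-1$ is not prime, or $l-1$ is a prime whose rank of appearance in $U$ is not $l$, then $U$ is $l$-defective; (2) if $l-1$ is a prime greater than $3$ with $(l-1)\nmid Q$ and $\rho_U(l-1)=l$, then $U$ is $(l-1)$-defective.
   Context: For nonzero integers $P,Q$, $U=U(P,Q)$ is defined by $U_0=0$, $U_1=1$, $U_{n+2}=PU_{n+1}-QU_n$; $\Delta=P^2-4Q$. $U$ is $\Delta$-regular if $U_n\neq0$ for all $n\geq1$, $\gcd(P,Q)=1$ and $\Delta\neq0$. For a prime $p\nmid Q$, the rank $\rho_U(p)$ is the least $n\geq1$ with $p\mid U_n$ (a prime dividing $Q$ has no rank). $n!_U=U_n\cdots U_1$, $0!_U=1$, and $C_{U,l}(n)=\frac{1}{U_{n+1}^l}\cdot\frac{((l+1)n)!_U}{(n!_U)^{l+1}}$. $C_{U,l}$ is multi-Catalan if $C_{U,l}(n)\in\mathbb{Z}$ for all but finitely many $n\geq1$. For $k\geq1$, $U$ is $k$-defective if there is no prime $p\nmid\Delta Q$ with $\rho_U(p)=k$. -}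

module Defs where

open import Data.Nat as ℕ using (ℕ; zero; suc)
open import Data.Nat.Primality using (Prime)
open import Data.Integer as ℤ using (ℤ; +_; _-_; _*_; _^_)
open import Data.Integer.Divisibility using (_∣_)
open import Data.Integer.GCD using (gcd)
open import Data.Product using (_×_; ∃-syntax)
open import Relation.Nullary using (¬_)
open import Relation.Binary.PropositionalEquality using (_≡_; _≢_)

lucasU : ℤ → ℤ → ℕ → ℤ
lucasU P Q zero = + 0
lucasU P Q (suc zero) = + 1
lucasU P Q (suc (suc n)) = P * lucasU P Q (suc n) - Q * lucasU P Q n

disc : ℤ → ℤ → ℤ
disc P Q = P * P - + 4 * Q

DeltaRegular : ℤ → ℤ → Set
DeltaRegular P Q =
  ((n : ℕ) → 1 ℕ.≤ n → lucasU P Q n ≢ + 0) × (gcd P Q ≡ + 1) × (disc P Q ≢ + 0)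

IsRank : ℤ → ℤ → ℕ → ℕ → Set
IsRank P Q p k =
  ¬ (+ p ∣ Q) × 1 ℕ.≤ k × (+ p ∣ lucasU P Q k)
  × ((m : ℕ) → 1 ℕ.≤ m → m ℕ.< k → ¬ (+ p ∣ lucasU P Q m))

lucasFact : ℤ → ℤ → ℕ → ℤ
lucasFact P Q zero = + 1
lucasFact P Q (suc n) = lucasU P Q (suc n) * lucasFact P Q n

-- C_{U,l}(n) ∈ ℤ, i.e. U_{n+1}^l (n!_U)^{l+1} divides ((l+1)n)!_U
-- (the denominator is nonzero under Δ-regularity)
CatalanIntegral : ℤ → ℤ → ℕ → ℕ → Set
CatalanIntegral P Q l n =
  (lucasU P Q (suc n) ^ l) * (lucasFact P Q n ^ suc l) ∣ lucasFact P Q (suc l ℕ.* n)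

MultiCatalan : ℤ → ℤ → ℕ → Set
MultiCatalan P Q l = ∃[ N ] ((n : ℕ) → 1 ℕ.≤ n → N ℕ.≤ n → CatalanIntegral P Q l n)

Defective : ℤ → ℤ → ℕ → Set
Defective P Q k =
  ¬ (∃[ p ] (Prime p × ¬ (+ p ∣ disc P Q * Q) × IsRank P Q p k))

{-# OPTIONS --safe #-}

-- Let p ∤ ΔQ be a prime of rank k ≤ l. The ratios U (n + 1) / U n take at most p + 1 values
-- modulo p, so k ≤ p + 1; and k ≠ p, since modulo p the Frobenius endomorphism of ℤ[α] gives
-- (α − β)^p = U p · (α − β), while α − β is a unit because its square Δ is. In both parts of the
-- theorem primality and parity then leave only l < p.
--
-- Now let M = n + 1 be the rank of a high power p^e. Up to p-adic units, U (q M + r) is U r for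
-- 0 < r < M, and U (q M) is U M for 0 < q < p. Hence the denominator U M ^ l · (n !_U) ^ (l + 1)
-- of C (n) has the same p-adic valuation as ((l + 1) M − 1)!_U. But ((l + 1) n)!_U lacks the
-- last l factors of that product, among them U ((l + 1) M − k), which p divides. So C (n) is not
-- an integer, and M is as large as we please since no term of U vanishes.

module Submission where

open import Defs
open import Algebra.Bundles using (CommutativeSemiring)
open import Algebra.Structures.Biased using (isCommutativeSemiringˡ)
open import Data.Empty using (⊥; ⊥-elim)
open import Data.Fin.Base as Fin using (Fin; toℕ; fromℕ<)
import Data.Fin.Properties as Finₚ
open import Data.Integer using (ℤ; +_; -[1+_]; -_; _+_; _-_; _*_; _^_; ≢-nonZero)
  renaming (∣_∣ to abs)
open import Data.Integer.DivMod using (_%ℕ_; _/ℕ_; a≡a%ℕn+[a/ℕn]*n; n%ℕd<d)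
open import Data.Integer.Divisibility using (_∣_)
open import Data.Integer.Divisibility.Signed renaming (_∣_ to _∣ₛ_)
import Data.Integer.Properties as ℤₚ
open import Data.Integer.Tactic.RingSolver using (solve-∀)
open import Data.Nat as ℕ using (ℕ; zero; suc; _≤_; _<_; _∸_; _!; z≤n; s≤s)
open import Data.Nat.Combinatorics using (_C_; nCn≡1; k![n∸k]!∣n!)
open import Data.Nat.Combinatorics.Specification using (nCk≡n!/k![n-k]!)
open import Data.Nat.Coprimality using (coprime-Bézout; Coprime)
import Data.Nat.Divisibility as ℕD
open import Data.Nat.DivMod using (m/n*n≡m)
open import Data.Nat.GCD using (module Bézout)
import Data.Nat.Induction as ℕI
open import Data.Nat.Primality using (Prime; euclidsLemma; prime⇒irreducible; prime⇒nonTrivial; prime⇒nonZero)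
import Data.Nat.Properties as ℕₚ
open import Data.Product using (_×_; _,_; ∃-syntax; ∃₂; proj₁; proj₂)
open import Data.Sum using (_⊎_; inj₁; inj₂; [_,_]′; map)
open import Level using (0ℓ)
open import Relation.Binary.PropositionalEquality using (_≡_; _≢_; refl; sym; trans; cong; cong₂; subst; subst₂; isEquivalence; module ≡-Reasoning)
open import Relation.Nullary using (¬_; yes; no)
open import Relation.Unary using (Decidable)

-- Addition formulas for Lucas sequences.

module LucasIdentities (P Q : ℤ) where

  U : ℕ → ℤ
  U = lucasU P Q

  -- Both sides obey the Lucas recurrence in `m`, so the cases `m` = 0 and `m` = 1 suffice.
  U-+-suc : ∀ m n → U (suc (m ℕ.+ n)) ≡ U (suc m) * U (suc n) - Q * (U m * U n)
  U-+-suc zero n = base (U (suc n)) Q (U n)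
    where
    base : ∀ x q y → x ≡ + 1 * x - q * (+ 0 * y)
    base = solve-∀
  U-+-suc (suc zero) n = base P Q (U (suc n)) (U n)
    where
    base : ∀ p q x y → p * x - q * y ≡ (p * + 1 - q * + 0) * x - q * (+ 1 * y)
    base = solve-∀
  U-+-suc (suc (suc m)) n =
    trans (cong₂ (λ x y → P * x - Q * y) (U-+-suc (suc m) n) (U-+-suc m n))
          (step P Q (U (suc m)) (U m) (U (suc n)) (U n))
    where
    step : ∀ p q a b x y →
           p * ((p * a - q * b) * x - q * (a * y)) - q * (a * x - q * (b * y)) ≡
           (p * (p * a - q * b) - q * a) * x - q * ((p * a - q * b) * y)
    step = solve-∀

  -- The factor `U (suc n) - P * U n` is -Q times the term of index n - 1, in a form that makes
  -- sense at `n` = 0.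
  U-+ : ∀ m n → U (m ℕ.+ n) ≡ U m * (U (suc n) - P * U n) + U (suc m) * U n
  U-+ zero n = base (U (suc n) - P * U n) (U n)
    where
    base : ∀ x y → y ≡ + 0 * x + + 1 * y
    base = solve-∀
  U-+ (suc zero) n = base P Q (U (suc n)) (U n)
    where
    base : ∀ p q x y → x ≡ + 1 * (x - p * y) + (p * + 1 - q * + 0) * y
    base = solve-∀
  U-+ (suc (suc m)) n =
    trans (cong₂ (λ x y → P * x - Q * y) (U-+ (suc m) n) (U-+ m n))
          (step P Q (U (suc m)) (U m) (U (suc n) - P * U n) (U n))
    where
    step : ∀ p q a b x y →
           p * (a * x + (p * a - q * b) * y) - q * (b * x + a * y) ≡
           (p * a - q * b) * x + (p * (p * a - q * b) - q * a) * y
    step = solve-∀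

  -- d'Ocagne's identity.
  U-cross : ∀ i d → U (suc i) * U (d ℕ.+ i) - U (suc (d ℕ.+ i)) * U i ≡ Q ^ i * U d
  U-cross zero d rewrite ℕₚ.+-identityʳ d = base (U d) (U (suc d))
    where
    base : ∀ x y → + 1 * x - y * + 0 ≡ + 1 * x
    base = solve-∀
  U-cross (suc i) d rewrite ℕₚ.+-suc d i =
    trans (step P Q (U (suc i)) (U i) (U (suc (d ℕ.+ i))) (U (d ℕ.+ i)))
          (trans (cong (Q *_) (U-cross i d)) (sym (ℤₚ.*-assoc Q (Q ^ i) (U d))))
    where
    step : ∀ p q a b c d →
           (p * a - q * b) * c - (p * c - q * d) * a ≡ q * (a * d - c * b)
    step = solve-∀

-- Least witnesses and sizes of powers.

least : ∀ {P : ℕ → Set} → Decidable P → ∀ n → P n → ∃[ m ] (P m × (∀ j → j < m → ¬ P j))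
least {P} P? = ℕI.<-rec _ step
  where
  step : ∀ n → (∀ {m} → m < n → P m → ∃[ m ] (P m × (∀ j → j < m → ¬ P j)))
       → P n → ∃[ m ] (P m × (∀ j → j < m → ¬ P j))
  step n rec Pn with ℕₚ.anyUpTo? P? n
  ... | yes (m , m<n , Pm) = rec m<n Pm
  ... | no none            = n , Pn , λ j j<n Pj → none (j , j<n , Pj)

n<m^n : ∀ m n → 2 ≤ m → n < m ℕ.^ n
n<m^n m zero    2≤m = s≤s z≤n
n<m^n m (suc n) 2≤m = begin
  suc (suc n)        ≤⟨ s≤s (n<m^n m n 2≤m) ⟩
  suc (m ℕ.^ n)      ≤⟨ ℕₚ.+-monoˡ-≤ (m ℕ.^ n) (ℕₚ.≤-trans (s≤s z≤n) (n<m^n m n 2≤m)) ⟩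
  m ℕ.^ n ℕ.+ m ℕ.^ n ≡⟨ cong (m ℕ.^ n ℕ.+_) (ℕₚ.+-identityʳ _) ⟨
  2 ℕ.* m ℕ.^ n      ≤⟨ ℕₚ.*-monoˡ-≤ (m ℕ.^ n) 2≤m ⟩
  m ℕ.* m ℕ.^ n      ∎
  where open ℕₚ.≤-Reasoning

∣+m^n∣ : ∀ m n → abs ((+ m) ^ n) ≡ m ℕ.^ n
∣+m^n∣ m zero    = refl
∣+m^n∣ m (suc n) = trans (ℤₚ.abs-* (+ m) ((+ m) ^ n)) (cong (m ℕ.*_) (∣+m^n∣ m n))

-- Comparison of valuations at a prime.

module PrimeDivisibility {p : ℕ} (pr : Prime p) where

  2≤p : 2 ≤ p
  2≤p = ℕ.nonTrivial⇒n>1 p where instance _ = prime⇒nonTrivial pr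

  p∤1 : ¬ (+ p ∣ₛ + 1)
  p∤1 d = ℕₚ.<⇒≢ 2≤p (sym (ℕD.∣1⇒≡1 (∣⇒∣ᵤ d)))

  euclid : ∀ x y → + p ∣ₛ x * y → + p ∣ₛ x ⊎ + p ∣ₛ y
  euclid x y d = map ∣ᵤ⇒∣ ∣ᵤ⇒∣
    (euclidsLemma (abs x) (abs y) pr (subst (p ℕD.∣_) (ℤₚ.abs-* x y) (∣⇒∣ᵤ d)))

  ∤-* : ∀ {x y} → ¬ (+ p ∣ₛ x) → ¬ (+ p ∣ₛ y) → ¬ (+ p ∣ₛ x * y)
  ∤-* {x} {y} p∤x p∤y d = [ p∤x , p∤y ]′ (euclid x y d)

  ∤-^ : ∀ {x} n → ¬ (+ p ∣ₛ x) → ¬ (+ p ∣ₛ x ^ n)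
  ∤-^ zero    p∤x = p∤1
  ∤-^ (suc n) p∤x = ∤-* p∤x (∤-^ n p∤x)

  ∤-< : ∀ {q} → 1 ≤ q → q < p → ¬ (+ p ∣ₛ + q)
  ∤-< {q} 1≤q q<p d = ℕD.>⇒∤ q<p (∣⇒∣ᵤ d)
    where instance _ = ℕ.>-nonZero 1≤q

  p^1+e∣⇒p∣ : ∀ e {x} → (+ p) ^ suc e ∣ₛ x → + p ∣ₛ x
  p^1+e∣⇒p∣ e d = ∣-trans (∣m⇒∣m*n ((+ p) ^ e) ∣-refl) d

  p^∣p^ : ∀ {a b} → a ≤ b → (+ p) ^ a ∣ₛ (+ p) ^ b
  p^∣p^ {b = b} z≤n = divides ((+ p) ^ b) (sym (ℤₚ.*-identityʳ ((+ p) ^ b)))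
  p^∣p^ (s≤s a≤b) = *-monoʳ-∣ (+ p) (p^∣p^ a≤b)

  -- A crude bound on the valuation: p ^ m exceeds m, so this power is larger than `abs y`.
  p^[1+∣y∣]∤y : ∀ {y} → y ≢ + 0 → ¬ ((+ p) ^ suc (abs y) ∣ₛ y)
  p^[1+∣y∣]∤y {y} y≢0 d = ℕₚ.<-asym (ℕₚ.n<1+n (abs y))
    (ℕₚ.<-≤-trans (n<m^n p (suc (abs y)) 2≤p)
      (subst (ℕ._≤ abs y) (∣+m^n∣ p (suc (abs y))) (ℕD.∣⇒≤ (∣⇒∣ᵤ d))))
    where instance _ = ≢-nonZero y≢0

  -- For nonzero integers, x ≈ y says that x and y have the same p-adic valuation.
  infix 4 _≈_
  _≈_ : ℤ → ℤ → Set
  x ≈ y = ∃₂ λ a b → ¬ (+ p ∣ₛ a) × ¬ (+ p ∣ₛ b) × a * x ≡ b * y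

  ≈-reflexive : ∀ {x y} → x ≡ y → x ≈ y
  ≈-reflexive x≡y = + 1 , + 1 , p∤1 , p∤1 , cong (+ 1 *_) x≡y

  ≈-refl : ∀ {x} → x ≈ x
  ≈-refl = ≈-reflexive refl

  ≈-trans : ∀ {x y z} → x ≈ y → y ≈ z → x ≈ z
  ≈-trans {x} {y} {z} (a , b , p∤a , p∤b , ax≡by) (c , d , p∤c , p∤d , cy≡dz) =
    c * a , b * d , ∤-* p∤c p∤a , ∤-* p∤b p∤d ,
    trans (trans (ℤₚ.*-assoc c a x) (cong (c *_) ax≡by))
      (trans (swap b c y) (trans (cong (b *_) cy≡dz) (sym (ℤₚ.*-assoc b d z))))
    where
    swap : ∀ b c y → c * (b * y) ≡ b * (c * y)
    swap = solve-∀

  ≈-* : ∀ {x y z w} → x ≈ y → z ≈ w → x * z ≈ y * w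
  ≈-* {x} {y} {z} {w} (a , b , p∤a , p∤b , ax≡by) (c , d , p∤c , p∤d , cz≡dw) =
    a * c , b * d , ∤-* p∤a p∤c , ∤-* p∤b p∤d ,
    trans (interchange a c x z) (trans (cong₂ _*_ ax≡by cz≡dw) (sym (interchange b d y w)))
    where
    interchange : ∀ a c x z → (a * c) * (x * z) ≡ (a * x) * (c * z)
    interchange = solve-∀

  -- Cancelling `y` from a x = b y would exhibit the unit b as a multiple of p.
  ≈⇒∤ : ∀ {x y} → y ≢ + 0 → x ≈ y → ¬ (+ p * y ∣ₛ x)
  ≈⇒∤ {x} {y} y≢0 (a , b , p∤a , p∤b , ax≡by) (divides z refl) =
    p∤b (divides (a * z) (ℤₚ.*-cancelʳ-≡ b (a * z * + p) y
      (trans (sym ax≡by) (assoc a z (+ p) y))))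
    where
    instance _ = ≢-nonZero y≢0
    assoc : ∀ a z p y → a * (z * (p * y)) ≡ a * z * p * y
    assoc = solve-∀

  -- The ultrametric principle: `d` has larger valuation than `u * y` and cannot disturb it. The
  -- induction strips a common factor p from `d` and `y` until p no longer divides `y`.
  ≈-perturb : ∀ e {d u y} → (+ p) ^ e ∣ₛ d → ¬ ((+ p) ^ e ∣ₛ y) → ¬ (+ p ∣ₛ u) → d + u * y ≈ y
  ≈-perturb zero {y = y} _ p^e∤y _ =
    ⊥-elim (p^e∤y (divides y (sym (ℤₚ.*-identityʳ y))))
  ≈-perturb (suc e) {d} {u} {y} p^e∣d p^e∤y p∤u with + p ∣? y
  ... | no p∤y =
    -- Both numbers are prime to p here, so each serves as the multiplier of the other.
    y , d + u * y , p∤y ,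
    (λ p∣d+uy → ∤-* p∤u p∤y (∣m+n∣m⇒∣n p∣d+uy (p^1+e∣⇒p∣ e p^e∣d))) ,
    ℤₚ.*-comm y (d + u * y)
  ... | yes (divides c refl) with p^e∣d
  ...   | divides q refl =
    let a , b , p∤a , p∤b , eq = ≈-perturb e {q * (+ p) ^ e} {u} {c} (∣n⇒∣m*n q ∣-refl)
          (λ p^e∣c → p^e∤y (subst ((+ p) ^ suc e ∣ₛ_) (ℤₚ.*-comm (+ p) c) (*-monoʳ-∣ (+ p) p^e∣c))) p∤u
    in a , b , p∤a , p∤b ,
       trans (factor a q (+ p) ((+ p) ^ e) u c) (trans (cong (_* + p) eq) (ℤₚ.*-assoc b c (+ p)))
    where
    factor : ∀ a q p r u c → a * (q * (p * r) + u * (c * p)) ≡ a * (q * r + u * c) * p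
    factor = solve-∀

-- Divisibility of Lucas terms by a prime and its powers.

module LucasDivisibility (P Q : ℤ) {p : ℕ} (pr : Prime p) (p∤Q : ¬ (+ p ∣ₛ Q)) where

  open LucasIdentities P Q public
  open PrimeDivisibility pr public

  F : ℕ → ℤ
  F = lucasFact P Q

  -- As p does not divide Q, the recurrence read backwards carries a common factor p of two
  -- neighbours down to U 1 = 1.
  ∣U⇒∤U-suc : ∀ n → + p ∣ₛ U n → ¬ (+ p ∣ₛ U (suc n))
  ∣U⇒∤U-suc zero    _    p∣U₁ = p∤1 p∣U₁
  ∣U⇒∤U-suc (suc n) p∣Uₙ p∣U = ∣U⇒∤U-suc n
    ([ (λ p∣Q → ⊥-elim (p∤Q p∣Q)) , (λ d → d) ]′
      (euclid Q (U n) (subst (+ p ∣ₛ_) (cancel (P * U (suc n)) (Q * U n))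
        (∣m∣n⇒∣m-n (∣n⇒∣m*n P p∣Uₙ) p∣U)))) p∣Uₙ
    where
    cancel : ∀ x y → x - (x - y) ≡ y
    cancel = solve-∀

  -- Modulo p, `U-+` reduces the left side to `U m * (U (suc k) - P * U k)`, and the second factor
  -- is congruent to the unit `U (suc k)`.
  ∣U-+-cancel : ∀ m k → + p ∣ₛ U k → + p ∣ₛ U (m ℕ.+ k) → + p ∣ₛ U m
  ∣U-+-cancel m k p∣Uk p∣U =
    [ (λ d → d) , (λ d → ⊥-elim (∣U⇒∤U-suc k p∣Uk
        (subst (+ p ∣ₛ_) (cancel (U (suc k)) (P * U k)) (∣m∣n⇒∣m+n d (∣n⇒∣m*n P p∣Uk))))) ]′
      (euclid (U m) (U (suc k) - P * U k)
        (∣m+n∣n⇒∣m (subst (+ p ∣ₛ_) (U-+ m k) p∣U) (∣n⇒∣m*n (U (suc m)) p∣Uk)))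
    where
    cancel : ∀ x y → x - y + y ≡ x
    cancel = solve-∀

  module Multiples (M : ℕ) (p∣UM : + p ∣ₛ U M) where

    -- By `U-+`, a shift of the index by `M` multiplies the terms of U by `g` modulo p.
    g : ℤ
    g = U (suc M)

    p∤g : ¬ (+ p ∣ₛ g)
    p∤g = ∣U⇒∤U-suc M p∣UM

    -- The quotient c is q g^(q - 1) modulo p; the extra factor `g` avoids the exponent q - 1.
    UM∣U[qM] : ∀ q → ∃[ c ] (U (q ℕ.* M) ≡ c * U M × + p ∣ₛ c * g - + q * g ^ q)
    U[1+qM]≡g^q : ∀ q → + p ∣ₛ U (suc (q ℕ.* M)) - g ^ q

    U[1+qM]≡g^q zero    = divides (+ 0) refl
    U[1+qM]≡g^q (suc q) = subst (+ p ∣ₛ_)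
      (sym (trans (cong (_- g ^ suc q) (U-+-suc M (q ℕ.* M)))
                  (rearrange g (U (suc (q ℕ.* M))) Q (U M) (U (q ℕ.* M)) (g ^ q))))
      (∣m∣n⇒∣m-n (∣n⇒∣m*n g (U[1+qM]≡g^q q)) (∣n⇒∣m*n Q (∣m⇒∣m*n (U (q ℕ.* M)) p∣UM)))
      where
      rearrange : ∀ g x q m y h → (g * x - q * (m * y)) - g * h ≡ g * (x - h) - q * (m * y)
      rearrange = solve-∀

    UM∣U[qM] zero    = + 0 , refl , divides (+ 0) refl
    UM∣U[qM] (suc q) with UM∣U[qM] q
    ... | c , eq , p∣ = c′ ,
      trans (U-+ M (q ℕ.* M))
        (trans (cong (λ y → U M * (x - P * y) + g * y) eq) (factor P (U M) x g c)) ,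
      subst (+ p ∣ₛ_) (sym (rearrange P (U M) x g c (+ q) (g ^ q)))
        (∣m∣n⇒∣m+n (∣m∣n⇒∣m-n (∣n⇒∣m*n g (U[1+qM]≡g^q q)) (∣n⇒∣m*n (P * c * g) p∣UM)) (∣n⇒∣m*n g p∣))
      where
      x  = U (suc (q ℕ.* M))
      -- The cofactor of `U M` in `U-+ M (q * M)`; modulo p it is g^q + g c.
      c′ = x - P * (c * U M) + g * c
      factor : ∀ P m x g c → m * (x - P * (c * m)) + g * (c * m) ≡ (x - P * (c * m) + g * c) * m
      factor = solve-∀
      rearrange : ∀ P m x g c q h →
        (x - P * (c * m) + g * c) * g - (+ 1 + q) * (g * h) ≡
        g * (x - h) - P * c * g * m + g * (c * g - q * h)
      rearrange = solve-∀

    ∣UM⇒∣U[qM] : ∀ {d} q → d ∣ₛ U M → d ∣ₛ U (q ℕ.* M)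
    ∣UM⇒∣U[qM] q d∣UM = let c , eq , _ = UM∣U[qM] q in
      subst (_ ∣ₛ_) (sym eq) (∣n⇒∣m*n c d∣UM)

    U[qM]≈UM : ∀ q → ¬ (+ p ∣ₛ + q) → U (q ℕ.* M) ≈ U M
    U[qM]≈UM q p∤q with UM∣U[qM] q
    ... | c , eq , p∣ = + 1 , c , p∤1 , p∤c , trans (ℤₚ.*-identityˡ _) eq
      where
      cancel : ∀ x y → x - (x - y) ≡ y
      cancel = solve-∀
      p∤c : ¬ (+ p ∣ₛ c)
      p∤c p∣c = ∤-* p∤q (∤-^ q p∤g)
        (subst (+ p ∣ₛ_) (cancel (c * g) (+ q * g ^ q)) (∣m∣n⇒∣m-n (∣m⇒∣m*n g p∣c) p∣))

    -- At q = p the residue q g^q vanishes, so the quotient itself acquires a factor p.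
    pUM∣U[pM] : + p * U M ∣ₛ U (p ℕ.* M)
    pUM∣U[pM] with UM∣U[qM] p
    ... | c , eq , p∣ = subst (+ p * U M ∣ₛ_) (sym eq) (*-monoˡ-∣ (U M) p∣c)
      where
      cancel : ∀ x y → x - y + y ≡ x
      cancel = solve-∀
      p∣c : + p ∣ₛ c
      p∣c = [ (λ d → d) , (λ d → ⊥-elim (p∤g d)) ]′ (euclid c g
        (subst (+ p ∣ₛ_) (cancel (c * g) (+ p * g ^ p)) (∣m∣n⇒∣m+n p∣ (∣m⇒∣m*n (g ^ p) ∣-refl))))

    -- `U-+` splits the term into a multiple of `U (q * M)`, hence of p^e, and a unit times `U r`,
    -- so `≈-perturb` applies.
    U[qM+r]≈Ur : ∀ e q r → (+ p) ^ e ∣ₛ U M → ¬ ((+ p) ^ e ∣ₛ U r) → U (r ℕ.+ q ℕ.* M) ≈ U r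
    U[qM+r]≈Ur e q r p^e∣ p^e∤ = subst (_≈ U r)
      (sym (trans (cong U (ℕₚ.+-comm r (q ℕ.* M))) (U-+ (q ℕ.* M) r)))
      (≈-perturb e (∣m⇒∣m*n _ (∣UM⇒∣U[qM] q p^e∣)) p^e∤
        (∣U⇒∤U-suc (q ℕ.* M) (∣UM⇒∣U[qM] q p∣UM)))

  -- Valuations of Lucas factorials, block by block.

  module Blocks (e n : ℕ) (p^e∣ : (+ p) ^ suc e ∣ₛ U (suc n))
    (p^e∤ : ∀ r → 1 ≤ r → r ≤ n → ¬ ((+ p) ^ suc e ∣ₛ U r)) where

    -- The hypotheses make `M` the rank of p^(e + 1); the exponent is a successor so that p itself
    -- divides `U M`.
    M : ℕ
    M = suc n

    open Multiples (suc n) (p^1+e∣⇒p∣ e p^e∣)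

    F-block : ∀ q r → suc q < p → r ≤ n →
              F (r ℕ.+ suc q ℕ.* M) ≈ F r * (U M * F (n ℕ.+ q ℕ.* M))
    F-block q zero q<p _ = ≈-trans
      (≈-* (U[qM]≈UM (suc q) (∤-< (s≤s z≤n) q<p)) ≈-refl)
      (≈-reflexive (sym (ℤₚ.*-identityˡ _)))
    F-block q (suc r) q<p r<n = ≈-trans
      (≈-* (U[qM+r]≈Ur (suc e) (suc q) (suc r) p^e∣ (p^e∤ (suc r) (s≤s z≤n) r<n))
           (F-block q r q<p (ℕₚ.<⇒≤ r<n)))
      (≈-reflexive (sym (ℤₚ.*-assoc (U (suc r)) (F r) _)))

    -- The indices up to (q + 1) M - 1 form q + 1 runs of length `n`, separated by the multiples M,
    -- ..., q M, whose multipliers are prime to p because `q < p`. At q = l the right side is the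
    -- denominator of C n.
    F-blocks : ∀ q → q < p → F (n ℕ.+ q ℕ.* M) ≈ U M ^ q * F n ^ suc q
    F-blocks zero q<p rewrite ℕₚ.+-identityʳ n = ≈-reflexive (base (F n))
      where
      base : ∀ x → x ≡ + 1 * (x * + 1)
      base = solve-∀
    F-blocks (suc q) q<p = ≈-trans (F-block q n q<p ℕₚ.≤-refl)
      (≈-trans (≈-* (≈-refl {F n}) (≈-* (≈-refl {U M}) (F-blocks q (ℕₚ.<⇒≤ q<p))))
        (≈-reflexive (rearrange (F n) (U M) (U M ^ q) (F n ^ suc q))))
      where
      rearrange : ∀ f u v w → f * (u * (v * w)) ≡ u * v * (f * w)
      rearrange = solve-∀

  U*F∣F : ∀ A i l → i < l → U (suc (i ℕ.+ A)) * F A ∣ₛ F (l ℕ.+ A)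
  U*F∣F A i (suc l) (s≤s i≤l) with ℕₚ.m≤n⇒m<n∨m≡n i≤l
  ... | inj₁ i<l  = ∣n⇒∣m*n (U (suc (l ℕ.+ A))) (U*F∣F A i l i<l)
  ... | inj₂ refl = *-monoʳ-∣ (U (suc (l ℕ.+ A))) (F∣F l)
    where
    F∣F : ∀ l → F A ∣ₛ F (l ℕ.+ A)
    F∣F zero    = ∣-refl
    F∣F (suc l) = ∣n⇒∣m*n (U (suc (l ℕ.+ A))) (F∣F l)

  -- Each multiplication of the index by p gains a factor p through `pUM∣U[pM]`. Hence every power
  -- of p has a rank.
  p^∣U[kp^] : ∀ {k} e → + p ∣ₛ U k → (+ p) ^ suc e ∣ₛ U (p ℕ.^ e ℕ.* k)
  p^∣U[kp^] {k} zero p∣Uk =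
    subst₂ (λ x y → x ∣ₛ U y) (sym (ℤₚ.*-identityʳ (+ p))) (sym (ℕₚ.+-identityʳ k)) p∣Uk
  p^∣U[kp^] {k} (suc e) p∣Uk = subst (λ x → (+ p) ^ suc (suc e) ∣ₛ U x)
    (sym (ℕₚ.*-assoc p (p ℕ.^ e) k))
    (∣-trans (*-monoʳ-∣ (+ p) ih) (Multiples.pUM∣U[pM] (p ℕ.^ e ℕ.* k) (p^1+e∣⇒p∣ e ih)))
    where
    ih = p^∣U[kp^] {k} e p∣Uk

  -- Large ranks and the failure of integrality.

  module _ (U≢0 : ∀ n → 1 ≤ n → U n ≢ + 0) where

    large-exponent : ∀ B → ∃[ e ] (∀ r → 1 ≤ r → r ≤ B → ¬ ((+ p) ^ suc e ∣ₛ U r))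
    large-exponent zero    = 0 , λ r 1≤r r≤0 → ⊥-elim (ℕₚ.<⇒≱ 1≤r r≤0)
    large-exponent (suc B) with large-exponent B
    -- The sum dominates both the exponent that serves the first `B` terms and the one that serves
    -- `U (suc B)`.
    ... | e , p^e∤ = e ℕ.+ abs (U (suc B)) , λ r 1≤r r≤1+B d → case r 1≤r d (ℕₚ.m≤n⇒m<n∨m≡n r≤1+B)
      where
      case : ∀ r → 1 ≤ r → (+ p) ^ suc (e ℕ.+ abs (U (suc B))) ∣ₛ U r → r < suc B ⊎ r ≡ suc B → ⊥
      case r 1≤r d (inj₁ (s≤s r≤B)) = p^e∤ r 1≤r r≤B (∣-trans (p^∣p^ (s≤s (ℕₚ.m≤m+n e _))) d)
      case r 1≤r d (inj₂ refl) =
        p^[1+∣y∣]∤y (U≢0 r 1≤r) (∣-trans (p^∣p^ (s≤s (ℕₚ.m≤n+m (abs (U (suc B))) e))) d)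

    -- Once p^(e + 1) divides none of the first `B` terms, its rank must exceed `B`.
    large-rank : ∀ {k} → 1 ≤ k → + p ∣ₛ U k → ∀ B → ∃₂ λ e n → B ≤ n × (+ p) ^ suc e ∣ₛ U (suc n) ×
                 (∀ r → 1 ≤ r → r ≤ n → ¬ ((+ p) ^ suc e ∣ₛ U r))
    large-rank {k} 1≤k p∣Uk B with large-exponent B
    ... | e , p^e∤ with p ℕ.^ e ℕ.* k in eq | p^∣U[kp^] {k} e p∣Uk
    ...   | zero  | _  = ⊥-elim (ℕ.≢-nonZero⁻¹ (p ℕ.^ e ℕ.* k) eq)
      where instance
        _ = prime⇒nonZero pr
        _ = ℕ.>-nonZero 1≤k
        _ = ℕₚ.m^n≢0 p e
        _ = ℕₚ.m*n≢0 (p ℕ.^ e) k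
    -- The search runs over successors because U 0 = 0 is divisible by everything.
    ...   | suc j | p^e∣ with least (λ m → (+ p) ^ suc e ∣? U (suc m)) j p^e∣
    ...     | n , p^e∣′ , minimal =
      e , n , ℕₚ.≮⇒≥ (λ n<B → p^e∤ (suc n) (s≤s z≤n) n<B p^e∣′) , p^e∣′ ,
      λ { (suc r) _ r<n → minimal r r<n }

    F≢0 : ∀ n → F n ≢ + 0
    F≢0 zero    ()
    F≢0 (suc n) eq with ℤₚ.i*j≡0⇒i≡0∨j≡0 (U (suc n)) eq
    ... | inj₁ U≡0 = U≢0 (suc n) (s≤s z≤n) U≡0
    ... | inj₂ F≡0 = F≢0 n F≡0

    -- Integrality would give the chain p D ∣ p F A ∣ F (n + l M), whereas F (n + l M) has the
    -- valuation of `D`.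
    small-rank⇒¬MultiCatalan : ∀ {k l} → 1 ≤ k → k ≤ l → l < p → + p ∣ₛ U k → ¬ MultiCatalan P Q l
    small-rank⇒¬MultiCatalan {k} {l} 1≤k k≤l l<p p∣Uk (N , integral)
      -- The summand `N` puts `n` in the range of integrality, and `l`, being at least 1, makes `n`
      -- positive.
      with large-rank 1≤k p∣Uk (N ℕ.+ l)
    ... | e , n , N+l≤n , p^e∣ , p^e∤ =
      ≈⇒∤ D≢0 (F-blocks l l<p) (∣-trans (*-monoʳ-∣ (+ p) D∣F) pF∣F)
      where
      open Blocks e n p^e∣ p^e∤
      open Multiples (suc n) (p^1+e∣⇒p∣ e p^e∣)
      A : ℕ
      A = suc l ℕ.* n
      D : ℤ
      D = U M ^ l * F n ^ suc l
      D∣F : D ∣ₛ F A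
      D∣F = ∣ᵤ⇒∣ (integral n
        (ℕₚ.≤-trans 1≤k (ℕₚ.≤-trans k≤l (ℕₚ.≤-trans (ℕₚ.m≤n+m l N) N+l≤n)))
        (ℕₚ.≤-trans (ℕₚ.m≤m+n N l) N+l≤n))
      top : n ℕ.+ l ℕ.* M ≡ l ℕ.+ A
      top = trans (cong (n ℕ.+_) (ℕₚ.*-suc l n))
              (trans (sym (ℕₚ.+-assoc n l _))
                (trans (cong (ℕ._+ l ℕ.* n) (ℕₚ.+-comm n l)) (ℕₚ.+-assoc l n _)))
      -- This choice makes 1 + i + A equal to (l + 1) M - k, an index among the last l before (l +
      -- 1) M. Since p divides both U ((l + 1) M) and `U k`, it divides the term there.
      i : ℕ
      i = l ∸ k
      i+k : suc (i ℕ.+ A) ℕ.+ k ≡ suc l ℕ.* M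
      i+k = cong suc (trans (cong (ℕ._+ k) (ℕₚ.+-comm i A))
              (trans (ℕₚ.+-assoc A i k)
                (trans (cong (A ℕ.+_) (ℕₚ.m∸n+n≡m k≤l))
                  (trans (ℕₚ.+-comm A l) (sym top)))))
      p∣U : + p ∣ₛ U (suc (i ℕ.+ A))
      p∣U = ∣U-+-cancel (suc (i ℕ.+ A)) k p∣Uk
        (subst (λ x → + p ∣ₛ U x) (sym i+k) (∣UM⇒∣U[qM] (suc l) (p^1+e∣⇒p∣ e p^e∣)))
      pF∣F : + p * F A ∣ₛ F (n ℕ.+ l ℕ.* M)
      pF∣F = subst (λ x → + p * F A ∣ₛ F x) (sym top)
        (∣-trans (*-monoˡ-∣ (F A) p∣U)
          (U*F∣F A i l (ℕₚ.∸-monoʳ-< 1≤k k≤l)))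
      ^≢0 : ∀ {x} m → x ≢ + 0 → x ^ m ≢ + 0
      ^≢0 {x} m x≢0 eq = x≢0 (ℤₚ.i^n≡0⇒i≡0 x m eq)
      D≢0 : D ≢ + 0
      D≢0 eq = [ ^≢0 l (U≢0 M (s≤s z≤n)) , ^≢0 (suc l) (F≢0 n) ]′
        (ℤₚ.i*j≡0⇒i≡0∨j≡0 (U M ^ l) eq)

-- Binomial coefficients and the Frobenius congruence.

p∤m! : ∀ {p m} → Prime p → m < p → ¬ (p ℕD.∣ m !)
p∤m! {p} {zero}  pr _   d = ℕₚ.<⇒≢ (ℕ.nonTrivial⇒n>1 p) (sym (ℕD.∣1⇒≡1 d))
  where instance _ = prime⇒nonTrivial pr
p∤m! {p} {suc m} pr m<p d =
  [ ℕD.>⇒∤ m<p , p∤m! pr (ℕₚ.<⇒≤ m<p) ]′ (euclidsLemma (suc m) (m !) pr d)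

n∣n! : ∀ n → .{{ℕ.NonZero n}} → n ℕD.∣ n !
n∣n! (suc n) = ℕD.m∣m*n (n !)

-- In p! = (p C k) k! (p - k)! the two factorials on the right have only factors below p.
p∣pCk : ∀ {p k} → Prime p → 1 ≤ k → k < p → p ℕD.∣ (p C k)
p∣pCk {p} {k} pr 1≤k k<p =
  [ (λ d → d) , (λ d → ⊥-elim (p∤k![p-k]! (euclidsLemma (k !) ((p ∸ k) !) pr d))) ]′
    (euclidsLemma (p C k) _ pr (subst (p ℕD.∣_) (sym pCk*k![p-k]!) (n∣n! p)))
  where
  instance
    _ = prime⇒nonZero pr
    _ = ℕₚ.m*n≢0 (k !) ((p ∸ k) !) {{ℕₚ._!≢0 k}} {{ℕₚ._!≢0 (p ∸ k)}}
  k≤p : k ≤ p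
  k≤p = ℕₚ.<⇒≤ k<p
  pCk*k![p-k]! : (p C k) ℕ.* (k ! ℕ.* (p ∸ k) !) ≡ p !
  pCk*k![p-k]! = trans (cong (ℕ._* (k ! ℕ.* (p ∸ k) !)) (nCk≡n!/k![n-k]! k≤p))
                         (m/n*n≡m (k![n∸k]!∣n! k≤p))
  p∤k![p-k]! : ¬ (p ℕD.∣ k ! ⊎ p ℕD.∣ (p ∸ k) !)
  p∤k![p-k]! = [ p∤m! pr k<p , p∤m! pr (ℕₚ.∸-monoʳ-< 1≤k k≤p) ]′

module Frobenius {a ℓ} (S : CommutativeSemiring a ℓ) where

  open CommutativeSemiring S
    using (Carrier; _≈_; 0#; semiring; setoid; +-commutativeMonoid;
           +-cong; +-congˡ; +-identityˡ; *-identityˡ; *-identityʳ)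
    renaming (_+_ to _⊕_; refl to ≈-refl; sym to ≈-sym; trans to ≈-trans)
  open import Algebra.Properties.Semiring.Exp semiring using () renaming (_^_ to _⊗^_)
  open import Algebra.Properties.Semiring.Mult semiring using (×-assocˡ; ×-homo-1; ×-congˡ)
    renaming (_×_ to _·_)
  open import Algebra.Properties.CommutativeMonoid.Mult +-commutativeMonoid using (×-distrib-+)
  open import Algebra.Properties.Semiring.Sum semiring using (sum; sum-init-last)
  open import Algebra.Properties.CommutativeSemiring.Binomial S using (theorem; binomial; binomialTerm)
  open import Data.Vec.Functional using (Vector; init; tail)
  open import Relation.Binary.Reasoning.Setoid setoid

  sum-multiple : ∀ m {n} (t : Vector Carrier n) → (∀ i → ∃[ w ] t i ≈ m · w) → ∃[ w ] sum t ≈ m · w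
  sum-multiple m {zero}  t h = 0# , ≈-sym (zero-multiple m)
    where
    zero-multiple : ∀ m → m · 0# ≈ 0#
    zero-multiple zero    = ≈-refl
    zero-multiple (suc m) = ≈-trans (+-identityˡ _) (zero-multiple m)
  sum-multiple m {suc n} t h =
    let w , eq = h Fin.zero; v , eqs = sum-multiple m (tail t) (λ i → h (Fin.suc i))
    in w ⊕ v , ≈-trans (+-cong eq eqs) (≈-sym (×-distrib-+ w v m))

  -- The binomial theorem with its two end terms split off. A semiring has no subtraction, so the
  -- congruence modulo p is given by an explicit multiple `p · z`.
  frobenius : ∀ {p} → Prime p → ∀ x y → ∃[ z ] (x ⊕ y) ⊗^ p ≈ y ⊗^ p ⊕ (p · z ⊕ x ⊗^ p)
  frobenius {suc n} pr x y =
    let z , middle = sum-multiple (suc n) (init (tail t)) multiple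
    in z , (begin
      (x ⊕ y) ⊗^ suc n
        ≈⟨ theorem (suc n) x y ⟩
      t Fin.zero ⊕ sum (tail t)
        ≈⟨ +-cong first (sum-init-last (tail t)) ⟩
      y ⊗^ suc n ⊕ (sum (init (tail t)) ⊕ t (Fin.fromℕ (suc n)))
        ≈⟨ +-congˡ (+-cong middle final) ⟩
      y ⊗^ suc n ⊕ (suc n · z ⊕ x ⊗^ suc n) ∎)
    where
    t = binomialTerm x y (suc n)
    first : t Fin.zero ≈ y ⊗^ suc n
    first = ≈-trans (×-homo-1 _) (*-identityˡ _)
    final : t (Fin.fromℕ (suc n)) ≈ x ⊗^ suc n
    final rewrite Finₚ.toℕ-fromℕ n | nCn≡1 (suc n) | ℕₚ.n∸n≡0 n =
      ≈-trans (×-homo-1 _) (*-identityʳ _)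
    multiple : ∀ i → ∃[ w ] init (tail t) i ≈ suc n · w
    -- Position `i` of the middle belongs to the exponent i + 1, strictly between 0 and p = n + 1.
    multiple i with p∣pCk {suc n} {suc (toℕ (Fin.inject₁ i))} pr (s≤s z≤n)
                      (s≤s (subst (_< n) (sym (Finₚ.toℕ-inject₁ i)) (Finₚ.toℕ<n i)))
    ... | ℕD.divides c eq = c · w ,
      ≈-trans (×-congˡ {w} (trans eq (ℕₚ.*-comm c (suc n)))) (≈-sym (×-assocˡ w (suc n) c))
      where w = binomial x y (suc n) (Fin.suc (Fin.inject₁ i))

-- The quadratic ring ℤ[α] and the case of rank p.

-- The pair (a , b) stands for a + b α in ℤ[α], where α² = P α − Q.
module QuadraticRing (P Q : ℤ) where

  infixl 6 _⊕_
  infixl 7 _⊗_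
  _⊕_ _⊗_ : ℤ × ℤ → ℤ × ℤ → ℤ × ℤ
  (a , b) ⊕ (c , d) = a + c , b + d
  (a , b) ⊗ (c , d) = a * c - Q * (b * d) , a * d + b * c + P * (b * d)

  ⊕-⊗-commutativeSemiring : CommutativeSemiring 0ℓ 0ℓ
  ⊕-⊗-commutativeSemiring = record
    { Carrier = ℤ × ℤ ; _≈_ = _≡_ ; _+_ = _⊕_ ; _*_ = _⊗_ ; 0# = + 0 , + 0 ; 1# = + 1 , + 0
    ; isCommutativeSemiring = isCommutativeSemiringˡ record
      { +-isCommutativeMonoid = record
        { isMonoid = record
          { isSemigroup = record
            { isMagma = record { isEquivalence = isEquivalence ; ∙-cong = cong₂ _⊕_ }
            ; assoc = λ (a , b) (c , d) (e , f) → cong₂ _,_ (ℤₚ.+-assoc a c e) (ℤₚ.+-assoc b d f)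
            }
          ; identity = (λ (a , b) → cong₂ _,_ (ℤₚ.+-identityˡ a) (ℤₚ.+-identityˡ b))
                     , (λ (a , b) → cong₂ _,_ (ℤₚ.+-identityʳ a) (ℤₚ.+-identityʳ b))
          }
        ; comm = λ (a , b) (c , d) → cong₂ _,_ (ℤₚ.+-comm a c) (ℤₚ.+-comm b d)
        }
      ; *-isCommutativeMonoid = record
        { isMonoid = record
          { isSemigroup = record
            { isMagma = record { isEquivalence = isEquivalence ; ∙-cong = cong₂ _⊗_ }
            ; assoc = λ (a , b) (c , d) (e , f) →
                cong₂ _,_ (assoc₁ P Q a b c d e f) (assoc₂ P Q a b c d e f)
            }
          ; identity = (λ (a , b) → cong₂ _,_ (idˡ₁ Q a b) (idˡ₂ P a b))
                     , (λ (a , b) → cong₂ _,_ (idʳ₁ Q a b) (idʳ₂ P a b))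
          }
        ; comm = λ (a , b) (c , d) → cong₂ _,_ (comm₁ Q a b c d) (comm₂ P a b c d)
        }
      ; distribʳ = λ (a , b) (c , d) (e , f) →
          cong₂ _,_ (distrib₁ Q a b c d e f) (distrib₂ P a b c d e f)
      ; zeroˡ = λ (a , b) → cong₂ _,_ (zero₁ Q a b) (zero₂ P a b)
      }
    }
    where
    assoc₁ : ∀ P Q a b c d e f →
      (a * c - Q * (b * d)) * e - Q * ((a * d + b * c + P * (b * d)) * f) ≡
      a * (c * e - Q * (d * f)) - Q * (b * (c * f + d * e + P * (d * f)))
    assoc₁ = solve-∀
    assoc₂ : ∀ P Q a b c d e f →
      (a * c - Q * (b * d)) * f + (a * d + b * c + P * (b * d)) * e
        + P * ((a * d + b * c + P * (b * d)) * f) ≡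
      a * (c * f + d * e + P * (d * f)) + b * (c * e - Q * (d * f))
        + P * (b * (c * f + d * e + P * (d * f)))
    assoc₂ = solve-∀
    idˡ₁ : ∀ Q a b → + 1 * a - Q * (+ 0 * b) ≡ a
    idˡ₁ = solve-∀
    idˡ₂ : ∀ P a b → + 1 * b + + 0 * a + P * (+ 0 * b) ≡ b
    idˡ₂ = solve-∀
    idʳ₁ : ∀ Q a b → a * + 1 - Q * (b * + 0) ≡ a
    idʳ₁ = solve-∀
    idʳ₂ : ∀ P a b → a * + 0 + b * + 1 + P * (b * + 0) ≡ b
    idʳ₂ = solve-∀
    comm₁ : ∀ Q a b c d → a * c - Q * (b * d) ≡ c * a - Q * (d * b)
    comm₁ = solve-∀
    comm₂ : ∀ P a b c d → a * d + b * c + P * (b * d) ≡ c * b + d * a + P * (d * b)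
    comm₂ = solve-∀
    distrib₁ : ∀ Q a b c d e f →
      (c + e) * a - Q * ((d + f) * b) ≡ (c * a - Q * (d * b)) + (e * a - Q * (f * b))
    distrib₁ = solve-∀
    distrib₂ : ∀ P a b c d e f →
      (c + e) * b + (d + f) * a + P * ((d + f) * b) ≡
      (c * b + d * a + P * (d * b)) + (e * b + f * a + P * (f * b))
    distrib₂ = solve-∀
    zero₁ : ∀ Q a b → + 0 * a - Q * (+ 0 * b) ≡ + 0
    zero₁ = solve-∀
    zero₂ : ∀ P a b → + 0 * b + + 0 * a + P * (+ 0 * b) ≡ + 0
    zero₂ = solve-∀

  open CommutativeSemiring ⊕-⊗-commutativeSemiring public using (semiring)
  open import Algebra.Properties.Semiring.Exp semiring public using () renaming (_^_ to _⊗^_)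
  open import Algebra.Properties.Semiring.Mult semiring public using () renaming (_×_ to _·_)

  -- The product of a + b α and its conjugate a + b β, expanded with α + β = P and α β = Q.
  norm : ℤ × ℤ → ℤ
  norm (a , b) = a * a + P * (a * b) + Q * (b * b)

  norm-⊗ : ∀ x y → norm (x ⊗ y) ≡ norm x * norm y
  norm-⊗ (a , b) (c , d) = identity P Q a b c d
    where
    identity : ∀ P Q a b c d →
      (a * c - Q * (b * d)) * (a * c - Q * (b * d))
        + P * ((a * c - Q * (b * d)) * (a * d + b * c + P * (b * d)))
        + Q * ((a * d + b * c + P * (b * d)) * (a * d + b * c + P * (b * d))) ≡
      (a * a + P * (a * b) + Q * (b * b)) * (c * c + P * (c * d) + Q * (d * d))
    identity = solve-∀

  norm-⊗^ : ∀ x n → norm (x ⊗^ n) ≡ norm x ^ n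
  norm-⊗^ x zero    = base P Q
    where
    base : ∀ P Q → + 1 * + 1 + P * (+ 1 * + 0) + Q * (+ 0 * + 0) ≡ + 1
    base = solve-∀
  norm-⊗^ x (suc n) = trans (norm-⊗ x (x ⊗^ n)) (cong (norm x *_) (norm-⊗^ x n))

  ·-components : ∀ n a b → n · (a , b) ≡ (+ n * a , + n * b)
  ·-components zero    a b = refl
  ·-components (suc n) a b =
    trans (cong ((a , b) ⊕_) (·-components n a b)) (cong₂ _,_ (step (+ n) a) (step (+ n) b))
    where
    step : ∀ n a → a + n * a ≡ (+ 1 + n) * a
    step = solve-∀

  open LucasIdentities P Q

  -- β = P − α is the conjugate of α, and δ = α − β is a square root of the discriminant.
  α β δ : ℤ × ℤ
  α = + 0 , + 1
  β = P , - + 1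
  δ = - P , + 2

  -- This ties the ring to the sequence: α² = P α - Q imposes the Lucas recurrence on the
  -- coordinates.
  α^ : ∀ n → α ⊗^ suc n ≡ (- (Q * U n) , U (suc n))
  α^ zero    = cong₂ _,_ (base₁ Q) (base₂ P)
    where
    base₁ : ∀ Q → + 0 * + 1 - Q * (+ 1 * + 0) ≡ - (Q * + 0)
    base₁ = solve-∀
    base₂ : ∀ P → + 0 * + 0 + + 1 * + 1 + P * (+ 1 * + 0) ≡ + 1
    base₂ = solve-∀
  α^ (suc n) = trans (cong (α ⊗_) (α^ n))
    (cong₂ _,_ (step₁ Q (U n) (U (suc n))) (step₂ P Q (U n) (U (suc n))))
    where
    step₁ : ∀ Q x y → + 0 * (- (Q * x)) - Q * (+ 1 * y) ≡ - (Q * y)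
    step₁ = solve-∀
    step₂ : ∀ P Q x y → + 0 * y + + 1 * (- (Q * x)) + P * (+ 1 * y) ≡ P * y - Q * x
    step₂ = solve-∀

  -- The conjugate of `α^`, rewritten in the basis 1, α through β = P - α.
  β^ : ∀ n → β ⊗^ suc n ≡ (P * U (suc n) - Q * U n , - U (suc n))
  β^ zero    = cong₂ _,_ (base₁ P Q) (base₂ P)
    where
    base₁ : ∀ P Q → P * + 1 - Q * ((- + 1) * + 0) ≡ P * + 1 - Q * + 0
    base₁ = solve-∀
    base₂ : ∀ P → P * + 0 + (- + 1) * + 1 + P * ((- + 1) * + 0) ≡ - + 1
    base₂ = solve-∀
  β^ (suc n) = trans (cong (β ⊗_) (β^ n))
    (cong₂ _,_ (step₁ P Q (U n) (U (suc n))) (step₂ P Q (U n) (U (suc n))))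
    where
    step₁ : ∀ P Q x y → P * (P * y - Q * x) - Q * ((- + 1) * (- y)) ≡ P * (P * y - Q * x) - Q * y
    step₁ = solve-∀
    step₂ : ∀ P Q x y → P * (- y) + (- + 1) * (P * y - Q * x) + P * ((- + 1) * (- y)) ≡ - (P * y - Q * x)
    step₂ = solve-∀

  norm-δ : norm δ ≡ - disc P Q
  norm-δ = identity P Q
    where
    identity : ∀ P Q → (- P) * (- P) + P * ((- P) * + 2) + Q * (+ 2 * + 2) ≡ - (P * P - + 4 * Q)
    identity = solve-∀

  -- The additive form of δ = α - β, to which the semiring version of Frobenius applies.
  δ⊕β≡α : δ ⊕ β ≡ α
  δ⊕β≡α = cong₂ _,_ (ℤₚ.+-inverseˡ P) refl

  -- Solving for the coordinates of `d` gives -(P u + m a) and 2 u - m b. The equation is that of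
  -- Frobenius, with `d` = δ^p and `u` = U p.
  ∣-components : ∀ {m} u v a b d → m ∣ₛ u →
    (- (Q * v) , u) ≡ (P * u - Q * v , - u) ⊕ ((m * a , m * b) ⊕ d) →
    m ∣ₛ proj₁ d × m ∣ₛ proj₂ d
  ∣-components {m} u v a b (x , y) m∣u eq =
    subst (m ∣ₛ_) (sym (solved₁ x (P * u) (Q * v) (m * a) (cong proj₁ eq)))
      (∣m⇒∣-m (∣m∣n⇒∣m+n (∣n⇒∣m*n P m∣u) (∣m⇒∣m*n a ∣-refl))) ,
    subst (m ∣ₛ_) (sym (solved₂ y u (m * b) (cong proj₂ eq)))
      (∣m∣n⇒∣m-n (∣m∣n⇒∣m+n m∣u m∣u) (∣m⇒∣m*n b ∣-refl))
    where
    isolate : ∀ x y z → x ≡ y + (z + x) - (y + z)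
    isolate = solve-∀
    solved₁ : ∀ x u v w → - v ≡ (u - v) + (w + x) → x ≡ - (u + w)
    solved₁ x u v w h =
      trans (isolate x (u - v) w) (trans (cong (_- (u - v + w)) (sym h)) (simplify u v w))
      where
      simplify : ∀ u v w → - v - (u - v + w) ≡ - (u + w)
      simplify = solve-∀
    solved₂ : ∀ x u w → u ≡ - u + (w + x) → x ≡ u + u - w
    solved₂ x u w h =
      trans (isolate x (- u) w) (trans (cong (_- (- u + w)) (sym h)) (simplify u w))
      where
      simplify : ∀ u w → u - (- u + w) ≡ u + u - w
      simplify = solve-∀

  ∣-norm : ∀ {m} x → m ∣ₛ proj₁ x × m ∣ₛ proj₂ x → m ∣ₛ norm x
  ∣-norm (a , b) (m∣a , m∣b) = ∣m∣n⇒∣m+n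
    (∣m∣n⇒∣m+n (∣m⇒∣m*n a m∣a) (∣n⇒∣m*n P (∣m⇒∣m*n b m∣a))) (∣n⇒∣m*n Q (∣m⇒∣m*n b m∣b))

  -- Modulo p, Frobenius gives (α − β)^p = α^p − β^p = U_p (α − β).
  ∣Up⇒∣δ^p : ∀ {p} → Prime p → + p ∣ₛ U p → + p ∣ₛ proj₁ (δ ⊗^ p) × + p ∣ₛ proj₂ (δ ⊗^ p)
  ∣Up⇒∣δ^p {suc n} pr p∣U = from-frobenius (Frobenius.frobenius ⊕-⊗-commutativeSemiring pr δ β)
    where
    p : ℕ
    p = suc n
    from-frobenius : ∃[ z ] (δ ⊕ β) ⊗^ p ≡ β ⊗^ p ⊕ (p · z ⊕ δ ⊗^ p) →
                     + p ∣ₛ proj₁ (δ ⊗^ p) × + p ∣ₛ proj₂ (δ ⊗^ p)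
    from-frobenius ((a , b) , eq) = ∣-components (U p) (U n) a b (δ ⊗^ p) p∣U
      (begin
        - (Q * U n) , U p                                     ≡⟨ α^ n ⟨
        α ⊗^ p                                                ≡⟨ cong (_⊗^ p) δ⊕β≡α ⟨
        (δ ⊕ β) ⊗^ p                                          ≡⟨ eq ⟩
        β ⊗^ p ⊕ (p · (a , b) ⊕ δ ⊗^ p)
          ≡⟨ cong₂ (λ x y → x ⊕ (y ⊕ δ ⊗^ p)) (β^ n) (·-components p a b) ⟩
        (P * U p - Q * U n , - U p) ⊕ ((+ p * a , + p * b) ⊕ δ ⊗^ p) ∎)
      where open ≡-Reasoning

  -- Divisibility of both coordinates of δ^p passes to its norm, which is (-Δ)^p by
  -- multiplicativity.
  ∣Up⇒∣disc : ∀ {p} → Prime p → + p ∣ₛ U p → + p ∣ₛ disc P Q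
  ∣Up⇒∣disc {p} pr p∣U with + p ∣? disc P Q
  ... | yes p∣Δ = p∣Δ
  ... | no p∤Δ = ⊥-elim (∤-^ p p∤-Δ
    (subst (+ p ∣ₛ_) (trans (norm-⊗^ δ p) (cong (_^ p) norm-δ)) (∣-norm (δ ⊗^ p) (∣Up⇒∣δ^p pr p∣U))))
    where
    open PrimeDivisibility pr
    p∤-Δ : ¬ (+ p ∣ₛ - disc P Q)
    p∤-Δ d = p∤Δ (subst (+ p ∣ₛ_) (ℤₚ.neg-involutive _) (∣m⇒∣-m d))

-- Inverses modulo p and the bound on the rank.

%ℕ≡⇒∣- : ∀ x y d .{{_ : ℕ.NonZero d}} → x %ℕ d ≡ y %ℕ d → + d ∣ₛ x - y
%ℕ≡⇒∣- x y d eq = divides (x /ℕ d - y /ℕ d)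
  (trans (cong₂ _-_ (a≡a%ℕn+[a/ℕn]*n x d) (a≡a%ℕn+[a/ℕn]*n y d))
    (trans (cong (λ r → + r + x /ℕ d * + d - (+ (y %ℕ d) + y /ℕ d * + d)) eq)
      (cancel (+ (y %ℕ d)) (x /ℕ d) (y /ℕ d) (+ d))))
  where
  cancel : ∀ r a b d → r + a * d - (r + b * d) ≡ (a - b) * d
  cancel = solve-∀

inverse-mod : ∀ {p} → Prime p → ∀ x → ¬ (+ p ∣ₛ x) → ∃[ y ] + p ∣ₛ x * y - + 1
inverse-mod {p} pr x p∤x = by-sign x (bézout (coprime-Bézout coprime))
  where
  coprime : Coprime (abs x) p
  coprime {d} (d∣x , d∣p) with prime⇒irreducible pr d∣p
  ... | inj₁ d≡1  = d≡1
  ... | inj₂ refl = ⊥-elim (p∤x (∣ᵤ⇒∣ d∣x))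
  bézout : ∀ {a} → Bézout.Identity.Identity 1 a p → ∃[ y ] + p ∣ₛ + a * y - + 1
  bézout {a} (Bézout.Identity.+- u v eq) = + u , divides (+ v)
    (trans (cong (_- + 1) (trans (ℤₚ.*-comm (+ a) (+ u))
        (trans (sym (ℤₚ.pos-* u a)) (trans (cong +_ (sym eq)) (cong (λ z → + 1 + z) (ℤₚ.pos-* v p))))))
      (cancel (+ v * + p)))
    where
    cancel : ∀ z → + 1 + z - + 1 ≡ z
    cancel = solve-∀
  bézout {a} (Bézout.Identity.-+ u v eq) = - + u , divides (- + v)
    (trans (rearrange (+ a) (+ u))
      (trans (cong -_ (trans (cong (λ z → + 1 + z) (sym (ℤₚ.pos-* u a))) (trans (cong +_ eq) (ℤₚ.pos-* v p))))
        (ℤₚ.neg-distribˡ-* (+ v) (+ p))))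
    where
    rearrange : ∀ a u → a * (- u) - + 1 ≡ - (+ 1 + u * a)
    rearrange = solve-∀
  by-sign : ∀ x → (∃[ y ] + p ∣ₛ + abs x * y - + 1) → ∃[ y ] + p ∣ₛ x * y - + 1
  by-sign (+ a)      inv       = inv
  by-sign (-[1+ a ]) (y , d)   = - y , subst (+ p ∣ₛ_) (cong (_- + 1) (signs (+ suc a) y)) d
    where
    signs : ∀ a y → a * y ≡ (- a) * (- y)
    signs = solve-∀

module RankBound (P Q : ℤ) {p : ℕ} (pr : Prime p) (p∤Q : ¬ (+ p ∣ₛ Q)) where

  open LucasDivisibility P Q pr p∤Q

  -- The p + 1 ratios U (i + 2) / U (i + 1) cannot be distinct modulo p, and by d'Ocagne's
  -- identity two equal ratios at distance d force p ∣ U d.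
  rank≤p+1 : ∀ {k} → (∀ m → 1 ≤ m → m < k → ¬ (+ p ∣ₛ U m)) → k ≤ suc p
  rank≤p+1 {k} minimal = ℕₚ.≮⇒≥ λ p+1<k → collision p+1<k
    (Finₚ.pigeonhole (ℕₚ.n<1+n p) (λ i → fromℕ< (n%ℕd<d (ratio p+1<k i) p)))
    where
    instance _ = prime⇒nonZero pr
    module _ (p+1<k : suc p < k) where
      -- The denominators U 1, ..., U (p + 1) have indices below `k`, so all are invertible modulo
      -- p.
      inv : (i : Fin (suc p)) → ∃[ y ] + p ∣ₛ U (suc (toℕ i)) * y - + 1
      inv i = inverse-mod pr (U (suc (toℕ i)))
        (minimal (suc (toℕ i)) (s≤s z≤n) (ℕₚ.≤-<-trans (Finₚ.toℕ<n i) p+1<k))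
      ratio : Fin (suc p) → ℤ
      ratio i = U (suc (suc (toℕ i))) * proj₁ (inv i)
      collision : (∃₂ λ i j → i Fin.< j ×
                   fromℕ< (n%ℕd<d (ratio i) p) ≡ fromℕ< (n%ℕd<d (ratio j) p)) → ⊥
      collision (i , j , i<j , eq) = [ ∤-^ (suc m) p∤Q , minimal d 1≤d d<k ]′
        (euclid (Q ^ suc m) (U d) (subst (+ p ∣ₛ_) (U-cross (suc m) d) p∣cross))
        where
        m n d : ℕ
        m = toℕ i
        n = toℕ j
        d = n ∸ m
        d+1+m : d ℕ.+ suc m ≡ suc n
        d+1+m = trans (ℕₚ.+-suc d m) (cong suc (ℕₚ.m∸n+n≡m (ℕₚ.<⇒≤ i<j)))
        1≤d : 1 ≤ d
        1≤d = ℕₚ.m<n⇒0<n∸m i<j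
        d<k : d < k
        d<k = ℕₚ.≤-<-trans (ℕₚ.m∸n≤m n m) (ℕₚ.<-trans (Finₚ.toℕ<n j) p+1<k)
        -- With y and z inverse to b and e modulo p, the cross difference is the difference of
        -- ratios times b e, corrected by the errors b y - 1 and e z - 1.
        expand : ∀ a b c e y z → a * e - c * b ≡
          (a * y - c * z) * (b * e) - a * e * (b * y - + 1) + c * b * (e * z - + 1)
        expand = solve-∀
        p∣cross : + p ∣ₛ U (suc (suc m)) * U (d ℕ.+ suc m) - U (suc (d ℕ.+ suc m)) * U (suc m)
        p∣cross rewrite d+1+m = subst (+ p ∣ₛ_)
          (sym (expand (U (suc (suc m))) (U (suc m)) (U (suc (suc n))) (U (suc n))
                       (proj₁ (inv i)) (proj₁ (inv j))))
          (∣m∣n⇒∣m+n (∣m∣n⇒∣m-n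
            (∣m⇒∣m*n (U (suc m) * U (suc n))
              (%ℕ≡⇒∣- (ratio i) (ratio j) p (Finₚ.fromℕ<-injective _ _ _ _ eq)))
            (∣n⇒∣m*n (U (suc (suc m)) * U (suc n)) (proj₂ (inv i))))
            (∣n⇒∣m*n (U (suc (suc n)) * U (suc m)) (proj₂ (inv j))))

  -- Below the bound p + 1 only `k` = p remains to be ruled out, and p ∣ U p would force p ∣ Δ.
  rank<p∨≡p+1 : ∀ {k} → ¬ (+ p ∣ₛ disc P Q) → + p ∣ₛ U k →
                (∀ m → 1 ≤ m → m < k → ¬ (+ p ∣ₛ U m)) → k < p ⊎ k ≡ suc p
  rank<p∨≡p+1 {k} p∤Δ p∣Uk minimal = cases (ℕₚ.m≤n⇒m<n∨m≡n (rank≤p+1 minimal))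
    where
    k≢p : k ≢ p
    k≢p k≡p = p∤Δ (QuadraticRing.∣Up⇒∣disc P Q pr (subst (λ n → + p ∣ₛ U n) k≡p p∣Uk))
    cases : k < suc p ⊎ k ≡ suc p → k < p ⊎ k ≡ suc p
    cases (inj₁ (s≤s k≤p)) = inj₁ (ℕₚ.≤∧≢⇒< k≤p k≢p)
    cases (inj₂ k≡p+1)     = inj₂ k≡p+1

-- Parity and the proof of the two defectiveness claims.

2∣n∨2∣1+n : ∀ n → 2 ℕD.∣ n ⊎ 2 ℕD.∣ suc n
2∣n∨2∣1+n zero    = inj₁ (2 ℕD.∣0)
2∣n∨2∣1+n (suc n) with 2∣n∨2∣1+n n
... | inj₁ 2∣n   = inj₂ (ℕD.∣m∣n⇒∣m+n ℕD.∣-refl 2∣n)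
... | inj₂ 2∣1+n = inj₁ 2∣1+n

-- One of the two numbers is even, and an even prime is 2.
consecutive-primes : ∀ {n} → Prime n → Prime (suc n) → n ≤ 2
consecutive-primes {n} prₙ prₙ₊₁ with 2∣n∨2∣1+n n
... | inj₁ 2∣n with prime⇒irreducible prₙ 2∣n
...   | inj₂ refl = ℕₚ.≤-refl
consecutive-primes {n} prₙ prₙ₊₁ | inj₂ 2∣1+n with prime⇒irreducible prₙ₊₁ 2∣1+n
...   | inj₂ refl = s≤s z≤n

module _ (l : ℕ) (P Q : ℤ) (U≢0 : ∀ n → 1 ≤ n → lucasU P Q n ≢ + 0) (mc : MultiCatalan P Q l) where

  -- The common core of both parts: `small-rank⇒¬MultiCatalan` removes the case k < p as soon as l <
  -- p. The last hypothesis is immediate for k = l; for k = l - 1 it amounts to p ≠ l.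
  rank-excluded : ∀ {k p} → Prime p → ¬ (+ p ∣ disc P Q * Q) → IsRank P Q p k → k ≤ l →
                  (k < p → l < p) → k ≡ suc p
  rank-excluded {k} {p} pr p∤ΔQ (p∤Q , 1≤k , p∣Uk , minimal) k≤l l<p =
    [ (λ k<p → ⊥-elim (small-rank⇒¬MultiCatalan U≢0 1≤k k≤l (l<p k<p) p∣ₛUk mc)) , (λ eq → eq) ]′
      (rank<p∨≡p+1 p∤ₛΔ p∣ₛUk minimalₛ)
    where
    p∤ₛQ : ¬ (+ p ∣ₛ Q)
    p∤ₛQ d = p∤Q (∣⇒∣ᵤ d)
    p∤ₛΔ : ¬ (+ p ∣ₛ disc P Q)
    p∤ₛΔ d = p∤ΔQ (∣⇒∣ᵤ {+ p} {disc P Q * Q} (∣m⇒∣m*n {+ p} {disc P Q} Q d))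
    p∣ₛUk : + p ∣ₛ lucasU P Q k
    p∣ₛUk = ∣ᵤ⇒∣ {+ p} {lucasU P Q k} p∣Uk
    minimalₛ : ∀ m → 1 ≤ m → m < k → ¬ (+ p ∣ₛ lucasU P Q m)
    minimalₛ m 1≤m m<k d = minimal m 1≤m m<k (∣⇒∣ᵤ d)
    open LucasDivisibility P Q pr p∤ₛQ using (small-rank⇒¬MultiCatalan)
    open RankBound P Q pr p∤ₛQ using (rank<p∨≡p+1)

theorem22 : (l : ℕ) → 2 ≤ l → (P Q : ℤ) → P ≢ + 0 → Q ≢ + 0
    → DeltaRegular P Q → MultiCatalan P Q l
    → ((¬ Prime (l ∸ 1)) ⊎ (Prime (l ∸ 1) × ¬ IsRank P Q (l ∸ 1) l) → Defective P Q l)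
      × (Prime (l ∸ 1) → 3 < l ∸ 1 → ¬ (+ (l ∸ 1) ∣ Q) → IsRank P Q (l ∸ 1) l
         → Defective P Q (l ∸ 1))
theorem22 (suc k) _ P Q _ _ (U≢0 , _ , _) mc = part₁ , part₂
  where
  part₁ : (¬ Prime k) ⊎ (Prime k × ¬ IsRank P Q k (suc k)) → Defective P Q (suc k)
  part₁ hyp (p , pr , p∤ΔQ , rank) =
    [ (λ ¬pr → ¬pr (subst Prime p≡k pr)) ,
      (λ (_ , ¬rank) → ¬rank (subst (λ n → IsRank P Q n (suc k)) p≡k rank)) ]′ hyp
    where
    -- Here l = k + 1, so l = p + 1 identifies p with l - 1, a prime of rank l, which either
    -- alternative of `hyp` forbids.
    p≡k : p ≡ k
    p≡k = sym (ℕₚ.suc-injective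
      (rank-excluded (suc k) P Q U≢0 mc pr p∤ΔQ rank ℕₚ.≤-refl (λ l<p → l<p)))
  part₂ : Prime k → 3 < k → ¬ (+ k ∣ Q) → IsRank P Q k (suc k) → Defective P Q k
  part₂ prₖ 3<k _ _ (p , pr , p∤ΔQ , rank) =
    ℕₚ.<⇒≱ 3<k (subst (_≤ 3) (sym k≡p+1) (s≤s (consecutive-primes pr (subst Prime k≡p+1 prₖ))))
    where
    p≢k+1 : suc k ≢ p
    -- Otherwise k and k + 1 would be consecutive primes. The remaining case k = p + 1 ends
    -- likewise, with p and k as the consecutive primes, so that k ≤ 3.
    p≢k+1 eq = ℕₚ.<⇒≱ 3<k
      (ℕₚ.m≤n⇒m≤1+n (consecutive-primes prₖ (subst Prime (sym eq) pr)))
    k≡p+1 : k ≡ suc p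
    k≡p+1 = rank-excluded (suc k) P Q U≢0 mc pr p∤ΔQ rank (ℕₚ.n≤1+n k)
      (λ k<p → ℕₚ.≤∧≢⇒< k<p p≢k+1)
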